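{- Let $R$ be a ring (unital and associative, not necessarily commutative). Let $n\in\mathbb{N}$ and $p\in\{0,1,\ldots,n\}$. Let $q=n-p$. Let $h_{k,\,i}$ be an element of $R$ for all $k\in\mathbb{Z}$ and $i\in[n]$. Assume that $$h_{k,\,i}=0\quad\text{for all }k<0\text{ and }i>q\ (\text{with } i\in[n]).$$ For any $m\in\{0,1,\ldots,n\}$ and any $\lambda\in\mathbb{Z}^m$, define $$s_\lambda:=\operatorname{rowdet}\left(\left(h_{\lambda_i+j-i,\,i}\right)_{i,j\in[m]}\right)\in R.$$ Set $$e_{p,\,q}:=\operatorname{rowdet}\left(\left(h_{1+j-i,\,q+i}\right)_{i,j\in[p]}\right)\in R.$$ Fix an $n$-tuple $\mu\in\mathbb{Z}^n$. Assume that $\mu_i=0$ for all $i>q$ (with $i\in[n]$). Let $\overline{\mu}=(\mu_1,\mu_2,\ldots,\mu_q)$. Then $$s_{\overline{\mu}}\cdot e_{p,\,q}=\sum_{\substack{\beta\in\{0,1\}^n;\\ |\beta|=p}}s_{\mu+\beta}.$$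
   Context: $\mathbb{N}=\{0,1,2,\ldots\}$ and $[m]=\{1,2,\ldots,m\}$. For a tuple $\alpha$, $\alpha_i$ denotes its $i$-th entry, and for $\alpha\in\mathbb{Z}^n$ we set $|\alpha|:=\alpha_1+\cdots+\alpha_n$. Addition of tuples is entrywise. $S_m$ is the group of permutations of $[m]$, and $(-1)^\sigma$ is the sign of $\sigma\in S_m$. For an $m\times m$-matrix $A=(a_{i,j})_{i,j\in[m]}$ over $R$ (whose $(i,j)$-th entry is $a_{i,j}$), the row-determinant is $$\operatorname{rowdet}A:=\sum_{\sigma\in S_m}(-1)^\sigma a_{1,\sigma(1)}a_{2,\sigma(2)}\cdots a_{m,\sigma(m)}\in R$$ (factors multiplied in this order). -}

module Defs where

open import Algebra.Bundles using (Ring; Semiring)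
import Algebra.Properties.Monoid.Sum as MonoidSum
open import Data.Fin.Base using (Fin; zero; suc; toℕ; inject≤; cast; punchIn; _↑ʳ_)
open import Data.Fin.Permutation as Perm
  using (Permutation′; _⟨$⟩ʳ_; insert; insert-punchIn)
open import Data.Fin.Properties using (punchIn-injective; _<?_)
open import Data.Integer.Base as ℤ using (ℤ; +_; 0ℤ; 1ℤ)
import Data.Integer.Properties as ℤₚ
open import Data.List.Base as List
  using (List; []; _∷_; length; filter; allFin; cartesianProduct; cartesianProductWith)
open import Data.List.Membership.Propositional using (_∈_)
open import Data.List.Membership.Propositional.Properties using (∈-allFin)
open import Data.List.Relation.Unary.All as All using (All; []; _∷_)
import Data.List.Relation.Unary.All.Properties as Allₚ
open import Data.List.Relation.Unary.AllPairs using ([]; _∷_)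
open import Data.List.Relation.Unary.Any using (Any; here; there)
import Data.List.Relation.Unary.Any.Properties as Anyₚ
open import Data.List.Relation.Unary.Enumerates.Setoid using (IsEnumeration)
import Data.List.Relation.Unary.Unique.Propositional.Properties as Uniqueₚ
open import Data.List.Relation.Unary.Unique.Setoid using (Unique)
import Data.List.Relation.Unary.Unique.Setoid.Properties as UniqueSₚ
open import Data.Nat.Base using (ℕ; zero; suc; _∸_; _≤_)
open import Data.Nat.Properties using (m∸n+n≡m)
open import Data.Product.Base using (_×_; _,_)
open import Data.Sum.Base using (_⊎_; inj₁; inj₂)
open import Data.Vec.Functional as Vector using (Vector)
open import Level using (0ℓ)
open import Relation.Binary.Bundles using (Setoid)
open import Relation.Binary.PropositionalEquality
  using (_≡_; refl; sym; trans; cong; _≗_; setoid; _→-setoid_)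
open import Relation.Nullary.Decidable using (_×-dec_)

------------------------------------------------------------------------
-- Indices and integer tuples

-- Elements of Fin m count from 0; `pos i` is the corresponding element
-- of {1, …, m}.
pos : ∀ {m} → Fin m → ℕ
pos i = suc (toℕ i)

∣_∣ : ∀ {n} → Vector ℤ n → ℤ
∣_∣ = MonoidSum.sum ℤₚ.+-0-monoid

_⊕_ : ∀ {n} → Vector ℤ n → Vector ℤ n → Vector ℤ n
_⊕_ = Vector.zipWith ℤ._+_

-- The first m entries of an n-tuple.
truncate : ∀ {a} {A : Set a} {m n} → .(m ≤ n) → Vector A n → Vector A m
truncate m≤n v i = v (inject≤ i m≤n)

-- For i ∈ {1, …, p}, the index (n - p) + i ∈ {1, …, n}.
shift : ∀ {n p} → .(p ≤ n) → Fin p → Fin n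
shift {n} {p} p≤n i = cast (m∸n+n≡m p≤n) ((n ∸ p) ↑ʳ i)

------------------------------------------------------------------------
-- {0,1}ⁿ as a list of integer tuples

bits : List ℤ
bits = 0ℤ ∷ 1ℤ ∷ []

binaryTuples : ∀ n → List (Vector ℤ n)
binaryTuples zero    = Vector.[] ∷ []
binaryTuples (suc n) = cartesianProductWith Vector._∷_ bits (binaryTuples n)

-- Functions are compared pointwise, since functional extensionality is
-- not available: the list contains exactly the 0-1 tuples, each once.

binaryTuples-complete : ∀ {n} (β : Vector ℤ n) → (∀ i → β i ≡ 0ℤ ⊎ β i ≡ 1ℤ) →
                        Any (β ≗_) (binaryTuples n)
binaryTuples-complete {zero}  β β01 = here λ ()
binaryTuples-complete {suc n} β β01 =
  Anyₚ.cartesianProductWith⁺ Vector._∷_ ∷-cong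
    (bit (β01 zero)) (binaryTuples-complete (λ i → β (suc i)) (λ i → β01 (suc i)))
  where
  bit : ∀ {b} → b ≡ 0ℤ ⊎ b ≡ 1ℤ → Any (b ≡_) bits
  bit (inj₁ b≡0) = here b≡0
  bit (inj₂ b≡1) = there (here b≡1)

  ∷-cong : ∀ {x v} → β zero ≡ x → (λ i → β (suc i)) ≗ v → β ≗ (x Vector.∷ v)
  ∷-cong p q zero    = p
  ∷-cong p q (suc i) = q i

binaryTuples-sound : ∀ n → All (λ β → ∀ i → β i ≡ 0ℤ ⊎ β i ≡ 1ℤ) (binaryTuples n)
binaryTuples-sound zero    = (λ ()) ∷ []
binaryTuples-sound (suc n) =
  Allₚ.cartesianProductWith⁺ (setoid ℤ) (setoid _) Vector._∷_ bits (binaryTuples n) cons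
  where
  cons : ∀ {b v} → b ∈ bits → v ∈ binaryTuples n →
         ∀ i → (b Vector.∷ v) i ≡ 0ℤ ⊎ (b Vector.∷ v) i ≡ 1ℤ
  cons (here b≡0)         _   zero    = inj₁ b≡0
  cons (there (here b≡1)) _   zero    = inj₂ b≡1
  cons _                  v∈  (suc i) = All.lookup (binaryTuples-sound n) v∈ i

binaryTuples-unique : ∀ n → Unique (Fin n →-setoid ℤ) (binaryTuples n)
binaryTuples-unique zero    = [] ∷ []
binaryTuples-unique (suc n) =
  UniqueSₚ.cartesianProductWith⁺ (setoid ℤ) (Fin n →-setoid ℤ) (Fin (suc n) →-setoid ℤ)
    Vector._∷_ (λ p → p zero , λ i → p (suc i))
    (((λ ()) ∷ []) ∷ [] ∷ []) (binaryTuples-unique n)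

------------------------------------------------------------------------
-- The symmetric group as a list

permutations : ∀ m → List (Permutation′ m)
permutations zero    = Perm.id ∷ []
permutations (suc m) = cartesianProductWith (insert zero) (allFin (suc m)) (permutations m)

permutationSetoid : ℕ → Setoid 0ℓ 0ℓ
permutationSetoid m = record
  { Carrier       = Permutation′ m
  ; _≈_           = Perm._≈_
  ; isEquivalence = record
    { refl  = λ _ → refl
    ; sym   = λ p i → sym (p i)
    ; trans = λ p q i → trans (p i) (q i)
    }
  }

permutations-complete : ∀ m → IsEnumeration (permutationSetoid m) (permutations m)
permutations-complete zero    π = here λ ()
permutations-complete (suc m) π =
  Anyₚ.cartesianProductWith⁺ (insert zero) inserted
    (∈-allFin (π ⟨$⟩ʳ zero)) (permutations-complete m (Perm.remove zero π))
  where
  inserted : ∀ {j ρ} → π ⟨$⟩ʳ zero ≡ j → Perm.remove zero π Perm.≈ ρ → π Perm.≈ insert zero j ρ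
  inserted         refl p zero    = refl
  inserted {ρ = ρ} refl p (suc i) =
    trans (Perm.punchIn-permute π zero i)
      (trans (cong (punchIn (π ⟨$⟩ʳ zero)) (p i)) (sym (insert-punchIn zero _ ρ i)))

permutations-unique : ∀ m → Unique (permutationSetoid m) (permutations m)
permutations-unique zero    = [] ∷ []
permutations-unique (suc m) =
  UniqueSₚ.cartesianProductWith⁺ (setoid _) (permutationSetoid m) (permutationSetoid (suc m))
    (insert zero) insert-injective (Uniqueₚ.allFin⁺ (suc m)) (permutations-unique m)
  where
  insert-injective : ∀ {i j : Fin (suc m)} {π ρ : Permutation′ m} →
                     insert zero i π Perm.≈ insert zero j ρ → i ≡ j × π Perm.≈ ρ
  insert-injective {i} {j} {π} {ρ} p with p zero
  ... | refl = refl , λ k → punchIn-injective i _ _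
    (trans (sym (insert-punchIn zero i π k)) (trans (p (suc k)) (insert-punchIn zero i ρ k)))

inversions : ∀ {m} → Permutation′ m → ℕ
inversions {m} σ =
  length (filter (λ (i , j) → (i <? j) ×-dec ((σ ⟨$⟩ʳ j) <? (σ ⟨$⟩ʳ i)))
                 (cartesianProduct (allFin m) (allFin m)))

------------------------------------------------------------------------
-- Row-determinants and the elements built from them

module _ {c ℓ} (R : Ring c ℓ) where
  open Ring R
  open import Algebra.Definitions.RawSemiring (Semiring.rawSemiring semiring) using (_^_)

  sumOver : ∀ {a} {A : Set a} → List A → (A → Carrier) → Carrier
  sumOver xs f = List.foldr (λ x acc → f x + acc) 0# xs

  -- (-1)^σ, where the sign of σ is determined by its number of inversions.
  sign : ∀ {m} → Permutation′ m → Carrier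
  sign σ = (- 1#) ^ inversions σ

  -- R need not be commutative: x₁ comes first in the product x₁ x₂ ⋯ xₘ.
  orderedProduct : ∀ {m} → Vector Carrier m → Carrier
  orderedProduct = Vector.foldr _*_ 1#

  rowdet : ∀ {m} → (Fin m → Fin m → Carrier) → Carrier
  rowdet {m} A =
    sumOver (permutations m) λ σ → sign σ * orderedProduct (λ i → A i (σ ⟨$⟩ʳ i))

  module _ {n} (h : ℤ → Fin n → Carrier) where

    s : ∀ {m} → .(m ≤ n) → Vector ℤ m → Carrier
    s m≤n κ = rowdet λ i j →
      h (κ i ℤ.+ (+ pos j) ℤ.- (+ pos i)) (inject≤ i m≤n)

    -- With p as the implicit argument and q = n - p, this is e_{p,q}.
    e : ∀ {p} → .(p ≤ n) → Carrier
    e p≤n = rowdet λ i j →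
      h (1ℤ ℤ.+ (+ pos j) ℤ.- (+ pos i)) (shift p≤n i)

{-# OPTIONS --safe #-}
-- Shifting the columns of a matrix instead of its rows, in all ways of a given
-- total weight, does not change the sum of its row-determinants: in each
-- summand of the expansions the substitution γ = β ∘ σ⁻¹ exchanges the two.
-- After a column shift by γ ∈ {0,1}ⁿ with a descent γⱼ = 1, γⱼ₊₁ = 0, columns
-- j and j + 1 agree and the row-determinant vanishes, so only
-- γ = (0,…,0,1,…,1) survives.  The corresponding matrix is block triangular,
-- and its diagonal blocks are those of s and e.
module Submission where

open import Defs
open import Algebra.Bundles using (CommutativeMonoid; Ring; Semiring)
import Algebra.Properties.CommutativeMonoid.Sum as CommutativeMonoidSum
import Algebra.Properties.CommutativeSemigroup as CommutativeSemigroupProperties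
import Algebra.Properties.Ring as RingProperties
open import Data.Bool.Base using (Bool; true; false; if_then_else_; _∧_)
open import Data.Fin.Base
  using (Fin; zero; suc; toℕ; fromℕ<; inject≤; cast; punchIn; _↑ˡ_; _↑ʳ_)
open import Data.Fin.Permutation using (Permutation′; _⟨$⟩ʳ_; insert; insert-punchIn)
open import Data.Fin.Properties
  using (_<?_; toℕ-↑ˡ; toℕ-↑ʳ; toℕ-inject≤; toℕ-injective; toℕ-fromℕ<; toℕ<n; inject≤-refl;
         cast-is-id)
open import Data.Integer.Base as ℤ using (ℤ; +_; 0ℤ; 1ℤ)
open import Data.Integer.Properties using (_≟_)
import Data.Integer.Properties as ℤₚ
open import Data.Integer.Solver using (module +-*-Solver)
open import Data.List.Base as List
  using (List; []; _∷_; _++_; length; filter; allFin; cartesianProduct; cartesianProductWith)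
import Data.List.Properties as Listₚ
open import Data.Nat.Base using (ℕ; zero; suc; _∸_; _≤_; _<_; _<ᵇ_; z≤n; s≤s; s≤s⁻¹)
import Data.Nat.Base as ℕ
open import Data.Nat.Properties using (≤-refl; m∸n≤m)
import Data.Nat.Properties as ℕₚ
open import Data.Product.Base using (_×_; _,_; ∃₂)
open import Data.Sum.Base using (_⊎_; inj₁; inj₂)
open import Data.Vec.Functional as Vector using (Vector; insertAt)
import Data.Vec.Functional.Properties as Vectorₚ
open import Function.Base using (_∘_)
open import Function.Bundles using (_⇔_; mk⇔; Equivalence)
open import Level using (Level)
open import Relation.Binary.PropositionalEquality
  using (_≡_; _≗_; refl; sym; trans; cong; cong₂; subst; module ≡-Reasoning)
import Relation.Binary.Reasoning.Setoid as SetoidReasoning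
open import Relation.Nullary.Decidable using (yes; no; does; _×-dec_)
open import Relation.Nullary.Negation using (contradiction; ¬_)
open import Relation.Unary using (Pred; Decidable)

private
  variable
    a b : Level
    X Y : Set a
    m n : ℕ

-- Indices

punchIn-<ᵇ : ∀ (j : Fin (suc n)) k l →
             (toℕ (punchIn j k) <ᵇ toℕ (punchIn j l)) ≡ (toℕ k <ᵇ toℕ l)
punchIn-<ᵇ zero    _       _       = refl
punchIn-<ᵇ (suc j) zero    zero    = refl
punchIn-<ᵇ (suc j) zero    (suc l) = refl
punchIn-<ᵇ (suc j) (suc k) zero    = refl
punchIn-<ᵇ (suc j) (suc k) (suc l) = punchIn-<ᵇ j k l

toℕ-punchIn-≤ : ∀ (j : Fin (suc n)) k → toℕ (punchIn j k) ≤ suc (toℕ k)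
toℕ-punchIn-≤ zero    k       = ≤-refl
toℕ-punchIn-≤ (suc j) zero    = z≤n
toℕ-punchIn-≤ (suc j) (suc k) = s≤s (toℕ-punchIn-≤ j k)

toℕ-punchIn-< : ∀ (j : Fin (suc n)) k → toℕ k < toℕ j → toℕ (punchIn j k) ≡ toℕ k
toℕ-punchIn-< (suc j) zero    _   = refl
toℕ-punchIn-< (suc j) (suc k) k<j = cong suc (toℕ-punchIn-< j k (s≤s⁻¹ k<j))

punchIn-↑ˡ-↑ˡ : ∀ (j : Fin (suc m)) k n → punchIn (j ↑ˡ n) (k ↑ˡ n) ≡ punchIn j k ↑ˡ n
punchIn-↑ˡ-↑ˡ zero    k       n = refl
punchIn-↑ˡ-↑ˡ (suc j) zero    n = refl
punchIn-↑ˡ-↑ˡ (suc j) (suc k) n = cong suc (punchIn-↑ˡ-↑ˡ j k n)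

punchIn-↑ˡ-↑ʳ : ∀ {m} (j : Fin (suc m)) (k : Fin n) → punchIn (j ↑ˡ n) (m ↑ʳ k) ≡ suc m ↑ʳ k
punchIn-↑ˡ-↑ʳ             zero    k = refl
punchIn-↑ˡ-↑ʳ {m = suc m} (suc j) k = cong suc (punchIn-↑ˡ-↑ʳ j k)

data Adjacent : ∀ {n} → Fin n → Fin n → Set where
  zero : Adjacent {suc (suc n)} zero (suc zero)
  suc  : ∀ {i j : Fin n} → Adjacent i j → Adjacent (suc i) (suc j)

toℕ-adjacent : ∀ {i j : Fin n} → Adjacent i j → toℕ j ≡ suc (toℕ i)
toℕ-adjacent zero      = refl
toℕ-adjacent (suc i⋖j) = cong suc (toℕ-adjacent i⋖j)

-- The increasing enumerations of the complements of `i` and of `j` differ at a single place, where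
-- one lists `j` and the other `i`. Hence the minors that delete either of two equal adjacent
-- columns coincide.
punchIn-adjacent : ∀ {i j : Fin (suc n)} → Adjacent i j → ∀ k →
                   punchIn i k ≡ punchIn j k ⊎ (punchIn i k ≡ j × punchIn j k ≡ i)
punchIn-adjacent zero zero    = inj₂ (refl , refl)
punchIn-adjacent zero (suc k) = inj₁ refl
punchIn-adjacent (suc i⋖j) zero = inj₁ refl
punchIn-adjacent (suc i⋖j) (suc k) with punchIn-adjacent i⋖j k
... | inj₁ p       = inj₁ (cong suc p)
... | inj₂ (p , q) = inj₂ (cong suc p , cong suc q)

-- Deleting an index `k` other than `i` and `j` removes nothing between them, so they stay adjacent
-- in the minor; this carries the induction in `det-adjacent-columns`.
adjacent-avoiding : ∀ {i j : Fin (suc n)} → Adjacent i j → ∀ k →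
  k ≡ i ⊎ k ≡ j ⊎ ∃₂ λ i′ j′ → Adjacent i′ j′ × punchIn k i′ ≡ i × punchIn k j′ ≡ j
adjacent-avoiding zero zero                = inj₁ refl
adjacent-avoiding zero (suc zero)          = inj₂ (inj₁ refl)
-- The implicit pattern exposes at least three indices, so that two remain for an adjacent pair
-- after the deletion.
adjacent-avoiding zero (suc (suc {suc _} k)) = inj₂ (inj₂ (zero , suc zero , zero , refl , refl))
adjacent-avoiding {suc n} (suc i⋖j) zero   = inj₂ (inj₂ (_ , _ , i⋖j , refl , refl))
adjacent-avoiding {suc n} (suc i⋖j) (suc k) with adjacent-avoiding i⋖j k
... | inj₁ p                               = inj₁ (cong suc p)
... | inj₂ (inj₁ p)                        = inj₂ (inj₁ (cong suc p))
... | inj₂ (inj₂ (i′ , j′ , i′⋖j′ , p , q)) =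
  inj₂ (inj₂ (suc i′ , suc j′ , suc i′⋖j′ , cong suc p , cong suc q))

-- Inversions

open CommutativeMonoidSum ℕₚ.+-0-commutativeMonoid
  using () renaming
  (sum to ∑; sum-cong-≗ to ∑-cong; sum-permute to ∑-permute; sum-replicate-zero to ∑-zero)

⟦_⟧ : Bool → ℕ
⟦ b ⟧ = if b then 1 else 0

length-filter-∷ : ∀ {p} {P : Pred X p} (P? : Decidable P) x xs →
                  length (filter P? (x ∷ xs)) ≡ ⟦ does (P? x) ⟧ ℕ.+ length (filter P? xs)
length-filter-∷ P? x xs with does (P? x)
... | true  = refl
... | false = refl

length-filter-tabulate : ∀ {p} {P : Pred X p} (P? : Decidable P) (f : Fin n → X) →
                         length (filter P? (List.tabulate f)) ≡ ∑ (λ i → ⟦ does (P? (f i)) ⟧)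
length-filter-tabulate {n = zero}  P? f = refl
length-filter-tabulate {n = suc n} P? f =
  trans (length-filter-∷ P? (f zero) (List.tabulate (f ∘ suc)))
        (cong (⟦ does (P? (f zero)) ⟧ ℕ.+_) (length-filter-tabulate P? (f ∘ suc)))

length-filter-cartesianProduct :
  ∀ {p} {P : Pred (X × Y) p} (P? : Decidable P) (f : Fin m → X) (g : Fin n → Y) →
  length (filter P? (cartesianProduct (List.tabulate f) (List.tabulate g)))
    ≡ ∑ (λ i → ∑ (λ j → ⟦ does (P? (f i , g j)) ⟧))
length-filter-cartesianProduct {m = zero}  P? f g = refl
length-filter-cartesianProduct {m = suc m} P? f g = begin
  length (filter P? (row ++ rest))                      ≡⟨ cong length (Listₚ.filter-++ P? row rest) ⟩
  length (filter P? row ++ filter P? rest)              ≡⟨ Listₚ.length-++ (filter P? row) ⟩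
  length (filter P? row) ℕ.+ length (filter P? rest)
    ≡⟨ cong₂ ℕ._+_
         (trans (cong (length ∘ filter P?) (Listₚ.map-tabulate g (f zero ,_)))
                (length-filter-tabulate P? (λ j → f zero , g j)))
         (length-filter-cartesianProduct P? (f ∘ suc) g) ⟩
  ∑ (λ i → ∑ (λ j → ⟦ does (P? (f i , g j)) ⟧))         ∎
  where
  open ≡-Reasoning
  row  = List.map (f zero ,_) (List.tabulate g)
  rest = cartesianProduct (List.tabulate (f ∘ suc)) (List.tabulate g)

-- Written in the form to which `does` reduces the decision in `inversions`, so that `inversions-∑`
-- holds by computation once the filter is counted.
inverted : Permutation′ n → Fin n → Fin n → Bool
inverted σ i j = (toℕ i <ᵇ toℕ j) ∧ (toℕ (σ ⟨$⟩ʳ j) <ᵇ toℕ (σ ⟨$⟩ʳ i))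

inversions-∑ : ∀ (σ : Permutation′ n) → inversions σ ≡ ∑ (λ i → ∑ (λ j → ⟦ inverted σ i j ⟧))
inversions-∑ σ =
  length-filter-cartesianProduct (λ (i , j) → (i <? j) ×-dec ((σ ⟨$⟩ʳ j) <? (σ ⟨$⟩ʳ i)))
    (λ i → i) (λ j → j)

count-punchIn-below : ∀ (j : Fin (suc n)) → ∑ (λ k → ⟦ toℕ (punchIn j k) <ᵇ toℕ j ⟧) ≡ toℕ j
count-punchIn-below {n}     zero    = ∑-zero n
count-punchIn-below {suc n} (suc j) = cong suc (count-punchIn-below j)

-- A pair with first position `zero` is inverted exactly when the later value lies below `j`, which
-- happens `toℕ j` times. The other pairs behave as in `π`, because `punchIn j` is increasing.
inversions-insert : ∀ (j : Fin (suc n)) (π : Permutation′ n) →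
                    inversions (insert zero j π) ≡ toℕ j ℕ.+ inversions π
inversions-insert j π = begin
  inversions (insert zero j π)
    ≡⟨ inversions-∑ (insert zero j π) ⟩
  -- Pairs whose second position is `zero` have already vanished by computation.
  ∑ (λ k → ⟦ toℕ (insert zero j π ⟨$⟩ʳ suc k) <ᵇ toℕ j ⟧) ℕ.+
  ∑ (λ i → ∑ (λ k → ⟦ inverted (insert zero j π) (suc i) (suc k) ⟧))
    ≡⟨ cong₂ ℕ._+_ first-row other-rows ⟩
  toℕ j ℕ.+ ∑ (λ i → ∑ (λ k → ⟦ inverted π i k ⟧))
    ≡⟨ cong (toℕ j ℕ.+_) (inversions-∑ π) ⟨
  toℕ j ℕ.+ inversions π ∎
  where
  open ≡-Reasoning

  value : ∀ k → insert zero j π ⟨$⟩ʳ suc k ≡ punchIn j (π ⟨$⟩ʳ k)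
  value = insert-punchIn zero j π

  first-row : ∑ (λ k → ⟦ toℕ (insert zero j π ⟨$⟩ʳ suc k) <ᵇ toℕ j ⟧) ≡ toℕ j
  first-row = begin
    ∑ (λ k → ⟦ toℕ (insert zero j π ⟨$⟩ʳ suc k) <ᵇ toℕ j ⟧)
      ≡⟨ ∑-cong (λ k → cong (λ v → ⟦ toℕ v <ᵇ toℕ j ⟧) (value k)) ⟩
    ∑ (λ k → ⟦ toℕ (punchIn j (π ⟨$⟩ʳ k)) <ᵇ toℕ j ⟧)
      -- The count runs over all positions, so reindexing by `π` removes it.
      ≡⟨ ∑-permute (λ k → ⟦ toℕ (punchIn j k) <ᵇ toℕ j ⟧) π ⟨
    ∑ (λ k → ⟦ toℕ (punchIn j k) <ᵇ toℕ j ⟧)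
      ≡⟨ count-punchIn-below j ⟩
    toℕ j ∎

  other-rows : ∑ (λ i → ∑ (λ k → ⟦ inverted (insert zero j π) (suc i) (suc k) ⟧)) ≡
               ∑ (λ i → ∑ (λ k → ⟦ inverted π i k ⟧))
  other-rows = ∑-cong λ i → ∑-cong λ k → cong (λ v → ⟦ (toℕ i <ᵇ toℕ k) ∧ v ⟧)
    (trans (cong₂ (λ v w → toℕ v <ᵇ toℕ w) (value k) (value i))
           (punchIn-<ᵇ j (π ⟨$⟩ʳ k) (π ⟨$⟩ʳ i)))

-- Weights of 0-1 tuples

weight-0∷ : ∀ (γ : Vector ℤ n) w → ∣ γ ∣ ≡ w ⇔ ∣ 0ℤ Vector.∷ γ ∣ ≡ w
weight-0∷ γ w = mk⇔ (trans (ℤₚ.+-identityˡ ∣ γ ∣)) (trans (sym (ℤₚ.+-identityˡ ∣ γ ∣)))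

weight-1∷ : ∀ (γ : Vector ℤ n) w → ∣ γ ∣ ≡ ℤ.pred w ⇔ ∣ 1ℤ Vector.∷ γ ∣ ≡ w
weight-1∷ γ w = mk⇔ (λ p → trans (cong ℤ.suc p) (ℤₚ.suc-pred w))
                    (λ p → trans (sym (ℤₚ.pred-suc ∣ γ ∣)) (cong ℤ.pred p))

-- The only weakly increasing 0-1 tuple of length `q + p` and weight `p`, hence the only one of that
-- weight without a descent.
sorted : ∀ q p → Vector ℤ (q ℕ.+ p)
sorted zero    zero    = Vector.[]
sorted zero    (suc p) = 1ℤ Vector.∷ sorted zero p
sorted (suc q) p       = 0ℤ Vector.∷ sorted q p

sorted-↑ˡ : ∀ {q} p (i : Fin q) → sorted q p (i ↑ˡ p) ≡ 0ℤ
sorted-↑ˡ p zero    = refl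
sorted-↑ˡ p (suc i) = sorted-↑ˡ p i

sorted-↑ʳ : ∀ q {p} (i : Fin p) → sorted q p (q ↑ʳ i) ≡ 1ℤ
sorted-↑ʳ (suc q) i       = sorted-↑ʳ q i
sorted-↑ʳ zero    zero    = refl
sorted-↑ʳ zero    (suc i) = sorted-↑ʳ zero i

module _ {c ℓ} (R : Ring c ℓ) where
  open Ring R using (Carrier; _≈_; _+_; _*_; _-_; -_; 0#; 1#; semiring)
  private
    module R = Ring R
    module Rₚ = RingProperties R
    open SetoidReasoning R.setoid
    open CommutativeSemigroupProperties (CommutativeMonoid.commutativeSemigroup R.+-commutativeMonoid)
      using (interchange)

  open import Algebra.Definitions.RawSemiring (Semiring.rawSemiring semiring) using (_^_)

  Matrix : ℕ → Set c
  Matrix m = Fin m → Fin m → Carrier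

  -- Finite sums

  sumOver-cong : ∀ (xs : List X) {f g : X → Carrier} → (∀ x → f x ≈ g x) →
                 sumOver R xs f ≈ sumOver R xs g
  sumOver-cong []       p = R.refl
  sumOver-cong (x ∷ xs) p = R.+-cong (p x) (sumOver-cong xs p)

  sumOver-++ : ∀ (xs ys : List X) f → sumOver R (xs ++ ys) f ≈ sumOver R xs f + sumOver R ys f
  sumOver-++ []       ys f = R.sym (R.+-identityˡ _)
  sumOver-++ (x ∷ xs) ys f = R.trans (R.+-congˡ (sumOver-++ xs ys f)) (R.sym (R.+-assoc _ _ _))

  sumOver-map : ∀ (k : X → Y) xs f → sumOver R (List.map k xs) f ≈ sumOver R xs (f ∘ k)
  sumOver-map k []       f = R.refl
  sumOver-map k (x ∷ xs) f = R.+-congˡ (sumOver-map k xs f)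

  sumOver-zero : ∀ (xs : List X) {f} → (∀ x → f x ≈ 0#) → sumOver R xs f ≈ 0#
  sumOver-zero []       p = R.refl
  sumOver-zero (x ∷ xs) p = R.trans (R.+-cong (p x) (sumOver-zero xs p)) (R.+-identityˡ 0#)

  sumOver-*ˡ : ∀ (xs : List X) y f → sumOver R xs (λ x → y * f x) ≈ y * sumOver R xs f
  sumOver-*ˡ []       y f = R.sym (R.zeroʳ y)
  sumOver-*ˡ (x ∷ xs) y f = R.trans (R.+-congˡ (sumOver-*ˡ xs y f)) (R.sym (R.distribˡ y _ _))

  sumOver-minus : ∀ (xs : List X) f g →
                  sumOver R xs (λ x → f x - g x) ≈ sumOver R xs f - sumOver R xs g
  sumOver-minus []       f g = R.sym (R.-‿inverseʳ 0#)
  sumOver-minus (x ∷ xs) f g = begin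
    (f x - g x) + sumOver R xs (λ y → f y - g y)              ≈⟨ R.+-congˡ (sumOver-minus xs f g) ⟩
    (f x - g x) + (sumOver R xs f - sumOver R xs g)           ≈⟨ interchange _ _ _ _ ⟩
    (f x + sumOver R xs f) + (- g x - sumOver R xs g)         ≈⟨ R.+-congˡ (Rₚ.-‿+-comm _ _) ⟩
    (f x + sumOver R xs f) - (g x + sumOver R xs g)           ∎

  sumOver-filter-map :
    ∀ {p q} {P : Pred X p} {Q : Pred Y q} (P? : Decidable P) (Q? : Decidable Q) (k : X → Y) →
    (∀ x → P x ⇔ Q (k x)) → ∀ xs f →
    sumOver R (filter Q? (List.map k xs)) f ≈ sumOver R (filter P? xs) (f ∘ k)
  sumOver-filter-map P? Q? k P⇔Q []       f = R.refl
  sumOver-filter-map P? Q? k P⇔Q (x ∷ xs) f with P? x | Q? (k x)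
  ... | yes _  | yes _  = R.+-congˡ (sumOver-filter-map P? Q? k P⇔Q xs f)
  ... | no  _  | no  _  = sumOver-filter-map P? Q? k P⇔Q xs f
  ... | yes px | no ¬qx = contradiction (Equivalence.to (P⇔Q x) px) ¬qx
  ... | no ¬px | yes qx = contradiction (Equivalence.from (P⇔Q x) qx) ¬px

  -- Alternating sums

  -- Nested subtraction carries the signs, so powers of `- 1#` enter only in the comparison with
  -- `rowdet`.
  alternatingSum : Vector Carrier n → Carrier
  alternatingSum {zero}  f = 0#
  alternatingSum {suc n} f = f zero - alternatingSum (f ∘ suc)

  alternatingSum-cong : ∀ {f g : Vector Carrier n} → (∀ i → f i ≈ g i) →
                        alternatingSum f ≈ alternatingSum g
  alternatingSum-cong {zero}  p = R.refl
  alternatingSum-cong {suc n} p =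
    R.+-cong (p zero) (R.-‿cong (alternatingSum-cong (λ i → p (suc i))))

  x-0≈x : ∀ x → x - 0# ≈ x
  x-0≈x x = R.trans (R.+-congˡ Rₚ.-0#≈0#) (R.+-identityʳ x)

  alternatingSum-zero : ∀ {f : Vector Carrier n} → (∀ i → f i ≈ 0#) → alternatingSum f ≈ 0#
  alternatingSum-zero {zero}  p = R.refl
  alternatingSum-zero {suc n} p =
    R.trans (R.+-cong (p zero) (R.-‿cong (alternatingSum-zero (λ i → p (suc i))))) (x-0≈x 0#)

  alternatingSum-+ : ∀ (f g : Vector Carrier n) →
                     alternatingSum (λ i → f i + g i) ≈ alternatingSum f + alternatingSum g
  alternatingSum-+ {zero}  f g = R.sym (R.+-identityˡ 0#)
  alternatingSum-+ {suc n} f g = begin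
    (f zero + g zero) - alternatingSum (λ i → f (suc i) + g (suc i))
      ≈⟨ R.+-congˡ (R.-‿cong (alternatingSum-+ (f ∘ suc) (g ∘ suc))) ⟩
    (f zero + g zero) - (alternatingSum (f ∘ suc) + alternatingSum (g ∘ suc))
      ≈⟨ R.+-congˡ (Rₚ.-‿+-comm _ _) ⟨
    (f zero + g zero) + (- alternatingSum (f ∘ suc) - alternatingSum (g ∘ suc))
      ≈⟨ interchange _ _ _ _ ⟩
    alternatingSum f + alternatingSum g ∎

  alternatingSum-*ʳ : ∀ (f : Vector Carrier n) y →
                      alternatingSum (λ i → f i * y) ≈ alternatingSum f * y
  alternatingSum-*ʳ {zero}  f y = R.sym (R.zeroˡ y)
  alternatingSum-*ʳ {suc n} f y = begin
    f zero * y - alternatingSum (λ i → f (suc i) * y)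
      ≈⟨ R.+-congˡ (R.-‿cong (alternatingSum-*ʳ (f ∘ suc) y)) ⟩
    f zero * y - alternatingSum (f ∘ suc) * y
      ≈⟨ Rₚ.[y-z]x≈yx-zx y _ _ ⟨
    alternatingSum f * y ∎

  alternatingSum-↑ˡ : ∀ q {p} (f : Vector Carrier (q ℕ.+ p)) → (∀ j → f (q ↑ʳ j) ≈ 0#) →
                      alternatingSum f ≈ alternatingSum (λ i → f (i ↑ˡ p))
  alternatingSum-↑ˡ zero    f p = alternatingSum-zero p
  alternatingSum-↑ˡ (suc q) f p = R.+-congˡ (R.-‿cong (alternatingSum-↑ˡ q (f ∘ suc) p))

  -- Neighbouring positions carry opposite signs, so the two equal terms cancel.
  alternatingSum-adjacent :
    ∀ {f : Vector Carrier n} {i j} → Adjacent i j → f i ≈ f j →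
    (∀ k → k ≡ i ⊎ k ≡ j ⊎ f k ≈ 0#) → alternatingSum f ≈ 0#
  alternatingSum-adjacent {f = f} zero fi≈fj off = begin
    f zero - (f (suc zero) - alternatingSum (λ k → f (suc (suc k))))
      ≈⟨ R.+-congˡ (R.-‿cong (R.+-congˡ (R.-‿cong (alternatingSum-zero rest)))) ⟩
    f zero - (f (suc zero) - 0#)   ≈⟨ R.+-cong fi≈fj (R.-‿cong (x-0≈x _)) ⟩
    f (suc zero) - f (suc zero)    ≈⟨ R.-‿inverseʳ _ ⟩
    0#                             ∎
    where
    rest : ∀ k → f (suc (suc k)) ≈ 0#
    rest k with off (suc (suc k))
    ... | inj₂ (inj₂ p) = p
  alternatingSum-adjacent {f = f} (suc i⋖j) fi≈fj off = begin
    f zero - alternatingSum (f ∘ suc)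
      ≈⟨ R.+-cong head (R.-‿cong (alternatingSum-adjacent i⋖j fi≈fj tail)) ⟩
    0# - 0#  ≈⟨ x-0≈x 0# ⟩
    0#       ∎
    where
    head : f zero ≈ 0#
    head with off zero
    ... | inj₂ (inj₂ p) = p
    tail : ∀ k → k ≡ _ ⊎ k ≡ _ ⊎ f (suc k) ≈ 0#
    tail k with off (suc k)
    ... | inj₁ refl        = inj₁ refl
    ... | inj₂ (inj₁ refl) = inj₂ (inj₁ refl)
    ... | inj₂ (inj₂ p)    = inj₂ (inj₂ p)

  sumOver-alternatingSum :
    ∀ (xs : List X) (f : X → Vector Carrier n) →
    sumOver R xs (λ x → alternatingSum (f x)) ≈ alternatingSum (λ i → sumOver R xs (λ x → f x i))
  sumOver-alternatingSum {n = zero}  xs f = sumOver-zero xs (λ _ → R.refl)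
  sumOver-alternatingSum {n = suc n} xs f = begin
    sumOver R xs (λ x → f x zero - alternatingSum (f x ∘ suc))
      ≈⟨ sumOver-minus xs _ _ ⟩
    sumOver R xs (λ x → f x zero) - sumOver R xs (λ x → alternatingSum (f x ∘ suc))
      ≈⟨ R.+-congˡ (R.-‿cong (sumOver-alternatingSum xs (λ x → f x ∘ suc))) ⟩
    alternatingSum (λ i → sumOver R xs (λ x → f x i)) ∎

  -- The row-determinant by expansion along the first row

  minor : Matrix (suc n) → Fin (suc n) → Matrix n
  minor A j i k = A (suc i) (punchIn j k)

  det : Matrix n → Carrier
  det {zero}  A = 1#
  det {suc n} A = alternatingSum (λ j → A zero j * det (minor A j))

  det-cong : ∀ {A B : Matrix n} → (∀ i j → A i j ≈ B i j) → det A ≈ det B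
  det-cong {zero}  p = R.refl
  det-cong {suc n} p = alternatingSum-cong λ j →
    R.*-cong (p zero j) (det-cong (λ i k → p (suc i) (punchIn j k)))

  -- Multiplying by `- 1#` on either side negates. In a noncommutative ring this is what lets the
  -- sign of a permutation move past a matrix entry.
  [-1]^n-central : ∀ n x → (- 1#) ^ n * x ≈ x * (- 1#) ^ n
  [-1]^n-central zero    x = R.trans (R.*-identityˡ x) (R.sym (R.*-identityʳ x))
  [-1]^n-central (suc n) x = begin
    - 1# * (- 1#) ^ n * x      ≈⟨ R.*-assoc _ _ _ ⟩
    - 1# * ((- 1#) ^ n * x)    ≈⟨ R.*-congˡ ([-1]^n-central n x) ⟩
    - 1# * (x * (- 1#) ^ n)    ≈⟨ R.*-assoc _ _ _ ⟨
    - 1# * x * (- 1#) ^ n      ≈⟨ R.*-congʳ (R.trans (Rₚ.-1*x≈-x x) (R.sym x*-1≈-x)) ⟩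
    x * - 1# * (- 1#) ^ n      ≈⟨ R.*-assoc _ _ _ ⟩
    x * (- 1# * (- 1#) ^ n)    ∎
    where
    x*-1≈-x : x * - 1# ≈ - x
    x*-1≈-x = R.trans (R.sym (Rₚ.-‿distribʳ-* x 1#)) (R.-‿cong (R.*-identityʳ x))

  [-1]^-+ : ∀ m n → (- 1#) ^ (m ℕ.+ n) ≈ (- 1#) ^ m * (- 1#) ^ n
  [-1]^-+ zero    n = R.sym (R.*-identityˡ _)
  [-1]^-+ (suc m) n = R.trans (R.*-congˡ ([-1]^-+ m n)) (R.sym (R.*-assoc _ _ _))

  -- The prefactor `y` makes the induction work: passing to the tail replaces it by `y * - 1#`,
  -- which turns explicit powers of `- 1#` into nested subtractions.
  sumOver-tabulate : ∀ y (k : Fin n → X) (F : X → Carrier) (f : Vector Carrier n) →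
                     (∀ i → F (k i) ≈ y * ((- 1#) ^ toℕ i * f i)) →
                     sumOver R (List.tabulate k) F ≈ y * alternatingSum f
  sumOver-tabulate {n = zero}  y k F f p = R.sym (R.zeroʳ y)
  sumOver-tabulate {n = suc n} y k F f p = begin
    F (k zero) + sumOver R (List.tabulate (k ∘ suc)) F
      ≈⟨ R.+-cong (R.trans (p zero) (R.*-congˡ (R.*-identityˡ _)))
                  (sumOver-tabulate (y * - 1#) (k ∘ suc) F (f ∘ suc) p′) ⟩
    y * f zero + y * - 1# * alternatingSum (f ∘ suc)
      ≈⟨ R.+-congˡ (R.trans (R.*-assoc _ _ _) (R.*-congˡ (Rₚ.-1*x≈-x _))) ⟩
    y * f zero + y * - alternatingSum (f ∘ suc)
      ≈⟨ R.distribˡ y _ _ ⟨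
    y * alternatingSum f ∎
    where
    p′ : ∀ i → F (k (suc i)) ≈ y * - 1# * ((- 1#) ^ toℕ i * f (suc i))
    p′ i = begin
      F (k (suc i))                                    ≈⟨ p (suc i) ⟩
      y * (- 1# * (- 1#) ^ toℕ i * f (suc i))          ≈⟨ R.*-congˡ (R.*-assoc _ _ _) ⟩
      y * (- 1# * ((- 1#) ^ toℕ i * f (suc i)))        ≈⟨ R.*-assoc _ _ _ ⟨
      y * - 1# * ((- 1#) ^ toℕ i * f (suc i))          ∎

  sumOver-cartesianProductWith :
    ∀ {Z : Set b} (k : X → Y → Z) xs ys (F : Z → Carrier) →
    sumOver R (cartesianProductWith k xs ys) F ≈ sumOver R xs (λ x → sumOver R ys (F ∘ k x))
  sumOver-cartesianProductWith k []       ys F = R.refl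
  sumOver-cartesianProductWith k (x ∷ xs) ys F =
    R.trans (sumOver-++ (List.map (k x) ys) _ F)
            (R.+-cong (sumOver-map (k x) ys F) (sumOver-cartesianProductWith k xs ys F))

  orderedProduct-cong : ∀ {f g : Vector Carrier n} → (∀ i → f i ≈ g i) →
                        orderedProduct R f ≈ orderedProduct R g
  orderedProduct-cong {zero}  p = R.refl
  orderedProduct-cong {suc n} p = R.*-cong (p zero) (orderedProduct-cong (λ i → p (suc i)))

  rowdet-term : Matrix n → Permutation′ n → Carrier
  rowdet-term A σ = sign R σ * orderedProduct R (λ i → A i (σ ⟨$⟩ʳ i))

  rowdet-term-insert : ∀ (A : Matrix (suc n)) j π →
    rowdet-term A (insert zero j π) ≈ (- 1#) ^ toℕ j * A zero j * rowdet-term (minor A j) π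
  rowdet-term-insert A j π = begin
    sign R (insert zero j π) *
      (A zero j * orderedProduct R (λ i → A (suc i) (insert zero j π ⟨$⟩ʳ suc i)))
      ≈⟨ R.*-cong
           (R.trans (R.reflexive (cong ((- 1#) ^_) (inversions-insert j π))) ([-1]^-+ (toℕ j) _))
           (R.*-congˡ (orderedProduct-cong λ i →
             R.reflexive (cong (A (suc i)) (insert-punchIn zero j π i)))) ⟩
    (- 1#) ^ toℕ j * sign R π * (A zero j * P)    ≈⟨ R.*-assoc _ _ _ ⟩
    (- 1#) ^ toℕ j * (sign R π * (A zero j * P))  ≈⟨ R.*-congˡ (R.*-assoc _ _ _) ⟨
    (- 1#) ^ toℕ j * (sign R π * A zero j * P)
      -- The sign of `π` moves past the first entry; the entries themselves keep their order.
      ≈⟨ R.*-congˡ (R.*-congʳ ([-1]^n-central (inversions π) (A zero j))) ⟩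
    (- 1#) ^ toℕ j * (A zero j * sign R π * P)    ≈⟨ R.*-congˡ (R.*-assoc _ _ _) ⟩
    (- 1#) ^ toℕ j * (A zero j * (sign R π * P))  ≈⟨ R.*-assoc _ _ _ ⟨
    (- 1#) ^ toℕ j * A zero j * (sign R π * P)    ∎
    where
    P = orderedProduct R (λ i → minor A j i (π ⟨$⟩ʳ i))

  -- `permutations (suc n)` lists each permutation by its image `j` of `zero` and a permutation `π`
  -- of the rest. Collecting the terms with the same `j` gives the first-row expansion; the order of
  -- factors is right because the first-row entry is leftmost in every product.
  rowdet≈det : ∀ (A : Matrix n) → rowdet R A ≈ det A
  rowdet≈det {zero}  A = R.trans (R.+-identityʳ _) (R.*-identityˡ 1#)
  rowdet≈det {suc n} A = begin
    rowdet R A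
      ≈⟨ sumOver-cartesianProductWith (insert zero) (allFin (suc n)) (permutations n) _ ⟩
    sumOver R (allFin (suc n)) (λ j → sumOver R (permutations n) (rowdet-term A ∘ insert zero j))
      ≈⟨ sumOver-tabulate 1# (λ j → j) _ _ (λ j → R.trans (column j) (R.sym (R.*-identityˡ _))) ⟩
    1# * det A
      ≈⟨ R.*-identityˡ _ ⟩
    det A ∎
    where
    column : ∀ j → sumOver R (permutations n) (rowdet-term A ∘ insert zero j) ≈
                   (- 1#) ^ toℕ j * (A zero j * det (minor A j))
    column j = begin
      sumOver R (permutations n) (rowdet-term A ∘ insert zero j)
        ≈⟨ sumOver-cong (permutations n) (rowdet-term-insert A j) ⟩
      sumOver R (permutations n) (λ π → (- 1#) ^ toℕ j * A zero j * rowdet-term (minor A j) π)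
        ≈⟨ sumOver-*ˡ (permutations n) _ _ ⟩
      (- 1#) ^ toℕ j * A zero j * rowdet R (minor A j)
        ≈⟨ R.*-congˡ (rowdet≈det (minor A j)) ⟩
      (- 1#) ^ toℕ j * A zero j * det (minor A j)
        ≈⟨ R.*-assoc _ _ _ ⟩
      (- 1#) ^ toℕ j * (A zero j * det (minor A j)) ∎

  -- Determinants that vanish or factor

  -- By induction on the size. The two terms that delete one of the equal columns have equal minors
  -- and opposite signs; every other minor still contains both columns side by side.
  det-adjacent-columns : ∀ (A : Matrix n) {i j} → Adjacent i j → (∀ k → A k i ≈ A k j) → det A ≈ 0#
  det-adjacent-columns {suc n} A {i} {j} i⋖j eq = alternatingSum-adjacent i⋖j
    (R.*-cong (eq zero) (det-cong same-minors)) other-minors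
    where
    same-minors : ∀ k l → minor A i k l ≈ minor A j k l
    same-minors k l with punchIn-adjacent i⋖j l
    ... | inj₁ p       = R.reflexive (cong (A (suc k)) p)
    ... | inj₂ (p , q) = R.trans (R.reflexive (cong (A (suc k)) p))
      (R.trans (R.sym (eq (suc k))) (R.reflexive (cong (A (suc k)) (sym q))))

    other-minors : ∀ k → k ≡ i ⊎ k ≡ j ⊎ A zero k * det (minor A k) ≈ 0#
    other-minors k with adjacent-avoiding i⋖j k
    ... | inj₁ p                               = inj₁ p
    ... | inj₂ (inj₁ p)                        = inj₂ (inj₁ p)
    ... | inj₂ (inj₂ (i′ , j′ , i′⋖j′ , refl , refl)) = inj₂ (inj₂ (R.trans
      (R.*-congˡ (det-adjacent-columns (minor A k) i′⋖j′ (λ l → eq (suc l)))) (R.zeroʳ _)))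

  -- The zero block has `n - r` rows and `r + 1` columns, together more than `n`, so every
  -- permutation meets it. Deleting the first row lowers `r` by one, since deleting a column shifts
  -- column indices by at most one; for `r = 0` the first column is zero.
  det-large-zero-block : ∀ r (A : Matrix n) → r < n →
    (∀ i j → r ≤ toℕ i → toℕ j ≤ r → A i j ≈ 0#) → det A ≈ 0#
  det-large-zero-block {suc n} zero A _ A≈0 = alternatingSum-zero term≈0
    where
    minor≈0 : ∀ j i k → zero ≤ toℕ i → toℕ k ≤ zero → minor A (suc j) i k ≈ 0#
    minor≈0 j i zero _ _ = A≈0 (suc i) zero z≤n z≤n

    term≈0 : ∀ j → A zero j * det (minor A j) ≈ 0#
    term≈0 zero    = R.trans (R.*-congʳ (A≈0 zero zero z≤n z≤n)) (R.zeroˡ _)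
    term≈0 (suc j) = R.trans
      -- The index `j` witnesses that the minor is nonempty, as the recursive call requires.
      (R.*-congˡ (det-large-zero-block zero (minor A (suc j)) (ℕₚ.≤-<-trans z≤n (toℕ<n j)) (minor≈0 j)))
      (R.zeroʳ _)
  det-large-zero-block {suc n} (suc r) A (s≤s r<n) A≈0 = alternatingSum-zero λ j →
    R.trans (R.*-congˡ {x = A zero j} (det-large-zero-block r (minor A j) r<n λ i k r≤i k≤r →
      A≈0 (suc i) (punchIn j k) (s≤s r≤i) (ℕₚ.≤-trans (toℕ-punchIn-≤ j k) (s≤s k≤r)))) (R.zeroʳ _)

  -- Induction on `q` along the first row. Deleting a left column keeps the block shape and the
  -- lower right block, whose determinant is then a common factor on the right of the sum. Deleting
  -- a right column leaves a zero block too large for a nonzero determinant.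
  det-block-triangular : ∀ q p (A : Matrix (q ℕ.+ p)) →
    (∀ i j → q ≤ toℕ i → toℕ j < q → A i j ≈ 0#) →
    det A ≈ det (λ i j → A (i ↑ˡ p) (j ↑ˡ p)) * det (λ i j → A (q ↑ʳ i) (q ↑ʳ j))
  det-block-triangular zero    p A A≈0 = R.sym (R.*-identityˡ _)
  det-block-triangular (suc q) p A A≈0 = begin
    det A
      ≈⟨ alternatingSum-↑ˡ (suc q) (λ j → A zero j * det (minor A j)) right-columns ⟩
    alternatingSum (λ j → A zero (j ↑ˡ p) * det (minor A (j ↑ˡ p)))
      ≈⟨ alternatingSum-cong (λ j → R.trans (R.*-congˡ {x = A₁₁ zero j} (left-columns j))
                                            (R.sym (R.*-assoc _ _ _))) ⟩
    alternatingSum (λ j → A zero (j ↑ˡ p) * det (minor A₁₁ j) * det A₂₂)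
      ≈⟨ alternatingSum-*ʳ (λ j → A₁₁ zero j * det (minor A₁₁ j)) (det A₂₂) ⟩
    det A₁₁ * det A₂₂ ∎
    where
    A₁₁ : Matrix (suc q)
    A₁₁ i j = A (i ↑ˡ p) (j ↑ˡ p)

    A₂₂ : Matrix p
    A₂₂ i j = A (suc q ↑ʳ i) (suc q ↑ʳ j)

    right-columns : ∀ j → A zero (suc q ↑ʳ j) * det (minor A (suc q ↑ʳ j)) ≈ 0#
    right-columns j = R.trans
      -- The first `suc q` columns survive the deletion, so the minor, of size `q + p`, has `p` rows
      -- that vanish in `q + 1` columns; `j` shows that `p` is positive.
      (R.*-congˡ (det-large-zero-block q (minor A (suc q ↑ʳ j))
        (ℕₚ.m<m+n q (ℕₚ.≤-trans (s≤s z≤n) (toℕ<n j)))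
        λ i k q≤i k≤q → A≈0 (suc i) _ (s≤s q≤i)
          (subst (_< suc q)
            (sym (toℕ-punchIn-< (suc q ↑ʳ j) k
              (subst (toℕ k <_) (sym (toℕ-↑ʳ (suc q) j)) (s≤s (ℕₚ.≤-trans k≤q (ℕₚ.m≤m+n q _))))))
            (s≤s k≤q))))
      (R.zeroʳ _)

    left-columns : ∀ j → det (minor A (j ↑ˡ p)) ≈ det (minor A₁₁ j) * det A₂₂
    left-columns j = R.trans
      (det-block-triangular q p (minor A (j ↑ˡ p)) λ i k q≤i k<q →
        A≈0 (suc i) _ (s≤s q≤i) (s≤s (ℕₚ.≤-trans (toℕ-punchIn-≤ (j ↑ˡ p) k) k<q)))
      (R.*-cong
        (det-cong λ i k → R.reflexive (cong (A (suc (i ↑ˡ p))) (punchIn-↑ˡ-↑ˡ j k p)))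
        (det-cong λ i k → R.reflexive (cong (A (suc (q ↑ʳ i))) (punchIn-↑ˡ-↑ʳ j k))))

  -- Sums over 0-1 tuples of a given weight

  -- The weight is an integer, so that splitting off a leading 1 can always pass to `ℤ.pred w`; a
  -- negative weight gives an empty sum.
  binarySum : ∀ n → ℤ → (Vector ℤ n → Carrier) → Carrier
  binarySum n w = sumOver R (filter (λ β → ∣ β ∣ ≟ w) (binaryTuples n))

  binarySum-cong : ∀ n w {f g : Vector ℤ n → Carrier} → (∀ γ → f γ ≈ g γ) →
                   binarySum n w f ≈ binarySum n w g
  binarySum-cong n w = sumOver-cong (filter (λ β → ∣ β ∣ ≟ w) (binaryTuples n))

  binarySum-zero : ∀ n w {f : Vector ℤ n → Carrier} → (∀ γ → f γ ≈ 0#) → binarySum n w f ≈ 0#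
  binarySum-zero n w = sumOver-zero (filter (λ β → ∣ β ∣ ≟ w) (binaryTuples n))

  binarySum-*ˡ : ∀ n w y (f : Vector ℤ n → Carrier) →
                 binarySum n w (λ γ → y * f γ) ≈ y * binarySum n w f
  binarySum-*ˡ n w = sumOver-*ˡ (filter (λ β → ∣ β ∣ ≟ w) (binaryTuples n))

  binarySum-alternatingSum : ∀ n w (f : Vector ℤ n → Vector Carrier m) →
    binarySum n w (λ γ → alternatingSum (f γ)) ≈ alternatingSum (λ i → binarySum n w (λ γ → f γ i))
  binarySum-alternatingSum n w = sumOver-alternatingSum (filter (λ β → ∣ β ∣ ≟ w) (binaryTuples n))

  binarySum-empty : ∀ {w} f → ¬ (w ≡ 0ℤ) → binarySum 0 w f ≈ 0#
  binarySum-empty {w} f w≢0 with 0ℤ ≟ w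
  ... | yes p = contradiction (sym p) w≢0
  ... | no  _ = R.refl

  binarySum-suc : ∀ n w f → binarySum (suc n) w f ≈
    binarySum n w (λ γ → f (0ℤ Vector.∷ γ)) + binarySum n (ℤ.pred w) (λ γ → f (1ℤ Vector.∷ γ))
  binarySum-suc n w f = begin
    sumOver R (filter P? (zeros ++ (ones ++ []))) f
      ≈⟨ R.reflexive (cong (λ xs → sumOver R (filter P? (zeros ++ xs)) f) (Listₚ.++-identityʳ ones)) ⟩
    sumOver R (filter P? (zeros ++ ones)) f
      ≈⟨ R.reflexive (cong (λ xs → sumOver R xs f) (Listₚ.filter-++ P? zeros ones)) ⟩
    sumOver R (filter P? zeros ++ filter P? ones) f
      ≈⟨ sumOver-++ (filter P? zeros) _ f ⟩
    sumOver R (filter P? zeros) f + sumOver R (filter P? ones) f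
      ≈⟨ R.+-cong (sumOver-filter-map (λ β → ∣ β ∣ ≟ w) P? _
                    (λ γ → weight-0∷ γ w) (binaryTuples n) f)
                  (sumOver-filter-map (λ β → ∣ β ∣ ≟ ℤ.pred w) P? _
                    (λ γ → weight-1∷ γ w) (binaryTuples n) f) ⟩
    binarySum n w (λ γ → f (0ℤ Vector.∷ γ)) + binarySum n (ℤ.pred w) (λ γ → f (1ℤ Vector.∷ γ)) ∎
    where
    P?    = λ (β : Vector ℤ (suc n)) → ∣ β ∣ ≟ w
    zeros = List.map (0ℤ Vector.∷_) (binaryTuples n)
    ones  = List.map (1ℤ Vector.∷_) (binaryTuples n)

  -- Splits at an arbitrary entry, where `binarySum-suc` splits at the first. The congruence
  -- assumption on `f` bridges tuples that agree only pointwise.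
  binarySum-insertAt : ∀ n w (j : Fin (suc n)) (f : Vector ℤ (suc n) → Carrier) →
    (∀ {γ δ} → γ ≗ δ → f γ ≈ f δ) →
    binarySum (suc n) w f ≈
      binarySum n w (λ γ → f (insertAt γ j 0ℤ)) + binarySum n (ℤ.pred w) (λ γ → f (insertAt γ j 1ℤ))
  binarySum-insertAt n w zero f f-cong = R.trans (binarySum-suc n w f) (R.+-cong
    (binarySum-cong n w λ γ → f-cong λ { zero → refl ; (suc _) → refl })
    (binarySum-cong n _ λ γ → f-cong λ { zero → refl ; (suc _) → refl }))
  binarySum-insertAt (suc n) w (suc j) f f-cong = begin
    binarySum (suc (suc n)) w f
      ≈⟨ binarySum-suc (suc n) w f ⟩
    binarySum (suc n) w (λ γ → f (0ℤ Vector.∷ γ)) + binarySum (suc n) (ℤ.pred w) (λ γ → f (1ℤ Vector.∷ γ))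
      ≈⟨ R.+-cong (expand 0ℤ w) (expand 1ℤ (ℤ.pred w)) ⟩
    (S 0ℤ 0ℤ w + S 0ℤ 1ℤ (ℤ.pred w)) + (S 1ℤ 0ℤ (ℤ.pred w) + S 1ℤ 1ℤ (ℤ.pred (ℤ.pred w)))
      -- The first argument of `S` is the head, the second the inserted entry. Exchanging the middle
      -- summands, both of weight `ℤ.pred w`, regroups the four sums by the inserted entry.
      ≈⟨ interchange _ _ _ _ ⟩
    (S 0ℤ 0ℤ w + S 1ℤ 0ℤ (ℤ.pred w)) + (S 0ℤ 1ℤ (ℤ.pred w) + S 1ℤ 1ℤ (ℤ.pred (ℤ.pred w)))
      ≈⟨ R.+-cong (collect 0ℤ w) (collect 1ℤ (ℤ.pred w)) ⟨
    binarySum (suc n) w (λ γ → f (insertAt γ (suc j) 0ℤ)) +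
    binarySum (suc n) (ℤ.pred w) (λ γ → f (insertAt γ (suc j) 1ℤ)) ∎
    where
    S : ℤ → ℤ → ℤ → Carrier
    S a b v = binarySum n v (λ γ → f (a Vector.∷ insertAt γ j b))

    expand : ∀ a v → binarySum (suc n) v (λ γ → f (a Vector.∷ γ)) ≈ S a 0ℤ v + S a 1ℤ (ℤ.pred v)
    expand a v = binarySum-insertAt n v j (λ γ → f (a Vector.∷ γ))
      λ p → f-cong λ { zero → refl ; (suc i) → p i }

    collect : ∀ b v → binarySum (suc n) v (λ γ → f (insertAt γ (suc j) b)) ≈ S 0ℤ b v + S 1ℤ b (ℤ.pred v)
    collect b v = R.trans (binarySum-suc n v _) (R.+-cong
      (binarySum-cong n v λ γ → f-cong λ { zero → refl ; (suc _) → refl })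
      (binarySum-cong n _ λ γ → f-cong λ { zero → refl ; (suc _) → refl }))

  -- The substitution `γ = β ∘ σ⁻¹`, done one row at a time. Row `zero`, expanded in column `j`,
  -- uses up the head of `β` on one side and the entry `γ j` on the other. Once these are split off,
  -- the remaining sums over minors agree by induction.
  binarySum-det-transpose : ∀ n w (a : Fin n → Fin n → ℤ → Carrier) →
    binarySum n w (λ β → det (λ i j → a i j (β i))) ≈ binarySum n w (λ γ → det (λ i j → a i j (γ j)))
  binarySum-det-transpose zero    w a = R.refl
  binarySum-det-transpose (suc n) w a = begin
    binarySum (suc n) w (λ β → det (λ i j → a i j (β i)))
      ≈⟨ binarySum-suc n w _ ⟩
    rowSum 0ℤ w + rowSum 1ℤ (ℤ.pred w)
      ≈⟨ R.+-cong (transposed 0ℤ w) (transposed 1ℤ (ℤ.pred w)) ⟩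
    alternatingSum (λ j → columnSum j 0ℤ w) + alternatingSum (λ j → columnSum j 1ℤ (ℤ.pred w))
      ≈⟨ alternatingSum-+ (λ j → columnSum j 0ℤ w) (λ j → columnSum j 1ℤ (ℤ.pred w)) ⟨
    alternatingSum (λ j → columnSum j 0ℤ w + columnSum j 1ℤ (ℤ.pred w))
      -- Each term of the expansion splits its sum at its own entry `j`.
      ≈⟨ alternatingSum-cong (λ j → R.sym (inserted j)) ⟩
    alternatingSum (λ j → binarySum (suc n) w (λ γ → term γ j))
      ≈⟨ binarySum-alternatingSum (suc n) w term ⟨
    binarySum (suc n) w (λ γ → det (λ i j → a i j (γ j))) ∎
    where
    rowMinor columnMinor : Fin (suc n) → Vector ℤ n → Matrix n
    rowMinor    j γ i k = a (suc i) (punchIn j k) (γ i)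
    columnMinor j γ i k = a (suc i) (punchIn j k) (γ k)

    term : Vector ℤ (suc n) → Vector Carrier (suc n)
    term γ j = a zero j (γ j) * det (columnMinor j (γ ∘ punchIn j))

    rowSum : ℤ → ℤ → Carrier
    rowSum b v = binarySum n v (λ γ → alternatingSum (λ j → a zero j b * det (rowMinor j γ)))

    columnSum : Fin (suc n) → ℤ → ℤ → Carrier
    columnSum j b v = binarySum n v (λ γ → a zero j b * det (columnMinor j γ))

    transposed : ∀ b v → rowSum b v ≈ alternatingSum (λ j → columnSum j b v)
    transposed b v = R.trans
      (binarySum-alternatingSum n v λ γ j → a zero j b * det (rowMinor j γ))
      (alternatingSum-cong λ j → begin
      binarySum n v (λ γ → a zero j b * det (rowMinor j γ))   ≈⟨ binarySum-*ˡ n v _ _ ⟩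
      a zero j b * binarySum n v (λ γ → det (rowMinor j γ))
        ≈⟨ R.*-congˡ (binarySum-det-transpose n v (λ i k → a (suc i) (punchIn j k))) ⟩
      a zero j b * binarySum n v (λ γ → det (columnMinor j γ)) ≈⟨ binarySum-*ˡ n v _ _ ⟨
      columnSum j b v ∎)

    term-insertAt : ∀ j b γ → term (insertAt γ j b) j ≈ a zero j b * det (columnMinor j γ)
    term-insertAt j b γ = R.*-cong
      (R.reflexive (cong (a zero j) (Vectorₚ.insertAt-lookup γ j b)))
      (det-cong λ i k → R.reflexive (cong (a (suc i) (punchIn j k)) (Vectorₚ.insertAt-punchIn γ j b k)))

    inserted : ∀ j → binarySum (suc n) w (λ γ → term γ j) ≈ columnSum j 0ℤ w + columnSum j 1ℤ (ℤ.pred w)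
    inserted j = R.trans
      (binarySum-insertAt n w j (λ γ → term γ j) λ p → R.*-cong
        (R.reflexive (cong (a zero j) (p j)))
        (det-cong λ i k → R.reflexive (cong (a (suc i) (punchIn j k)) (p (punchIn j k)))))
      (R.+-cong (binarySum-cong n _ (term-insertAt j 0ℤ)) (binarySum-cong n _ (term-insertAt j 1ℤ)))

  -- Functions vanishing on tuples with a descent

  VanishesOnDescents : (Vector ℤ n → Carrier) → Set ℓ
  VanishesOnDescents g = ∀ γ {i j} → Adjacent i j → γ i ≡ 1ℤ → γ j ≡ 0ℤ → g γ ≈ 0#

  vanishesOnDescents-∷ : ∀ {g : Vector ℤ (suc n) → Carrier} b → VanishesOnDescents g →
                         VanishesOnDescents (λ γ → g (b Vector.∷ γ))
  vanishesOnDescents-∷ b van γ i⋖j = van (b Vector.∷ γ) (suc i⋖j)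

  -- A 0-1 tuple of length `n` has at most `n` ones, so the sum is empty.
  binarySum-overweight : ∀ n w f → + n ℤ.< w → binarySum n w f ≈ 0#
  binarySum-overweight zero    w f 0<w = binarySum-empty {w} f (λ { refl → ℤₚ.<-irrefl refl 0<w })
  binarySum-overweight (suc n) w f n<w = R.trans (binarySum-suc n w f)
    (R.trans (R.+-cong
      (binarySum-overweight n w _ (ℤₚ.<-trans (ℤ.+<+ (ℕₚ.n<1+n n)) n<w))
      (binarySum-overweight n _ _ (subst (ℤ._< ℤ.pred w) (ℤₚ.pred-suc (+ n)) (ℤₚ.+-monoʳ-< ℤ.-1ℤ n<w))))
    (R.+-identityˡ 0#))

  -- The tail has weight below its length, so it contains a 0, and the first 0 after the leading 1
  -- ends a descent. The induction moves along the leading ones: each lowers length and weight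
  -- together.
  binarySum-1∷ : ∀ n w (g : Vector ℤ (suc n) → Carrier) → VanishesOnDescents g → w ℤ.< + n →
                 binarySum n w (λ γ → g (1ℤ Vector.∷ γ)) ≈ 0#
  binarySum-1∷ zero    w g van w<0 = binarySum-empty {w} _ (λ { refl → ℤₚ.<-irrefl refl w<0 })
  binarySum-1∷ (suc n) w g van w<n = R.trans (binarySum-suc n w _)
    (R.trans (R.+-cong
      (binarySum-zero n w (λ γ → van _ zero refl refl))
      (binarySum-1∷ n _ _ (vanishesOnDescents-∷ {g = g} 1ℤ van)
        (subst (ℤ.pred w ℤ.<_) (ℤₚ.pred-suc (+ n)) (ℤₚ.+-monoʳ-< ℤ.-1ℤ w<n))))
    (R.+-identityˡ 0#))

  -- The first entry is forced at each stage. For `q = 0` a leading 0 leaves fewer places than the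
  -- weight asks for; for `q > 0` a leading 1 leaves a tail of weight below its length, hence a
  -- descent.
  binarySum-sorted : ∀ q p (g : Vector ℤ (q ℕ.+ p) → Carrier) → VanishesOnDescents g →
                     binarySum (q ℕ.+ p) (+ p) g ≈ g (sorted q p)
  binarySum-sorted zero zero    g van = R.+-identityʳ _
  binarySum-sorted zero (suc p) g van = R.trans (binarySum-suc p _ g) (R.trans (R.+-cong
      (binarySum-overweight p (+ suc p) _ (ℤ.+<+ (ℕₚ.n<1+n p)))
      (binarySum-sorted zero p _ (vanishesOnDescents-∷ {g = g} 1ℤ van)))
    (R.+-identityˡ _))
  binarySum-sorted (suc q) p    g van = R.trans (binarySum-suc (q ℕ.+ p) _ g) (R.trans (R.+-cong
      (binarySum-sorted q p _ (vanishesOnDescents-∷ {g = g} 0ℤ van))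
      (binarySum-1∷ (q ℕ.+ p) _ g van
        (ℤₚ.<-≤-trans (ℤₚ.i≤pred[j]⇒i<j ℤₚ.≤-refl) (ℤ.+≤+ (ℕₚ.m≤n+m p q)))))
    (R.+-identityʳ _))

  -- The identity for n = q + p

  -- With `n` in the form `q + p`, the blocks are indexed by `_↑ˡ_` and `_↑ʳ_`. The second factor is
  -- `e` unfolded, its `shift` written with `q` in place of `n ∸ p`.
  pieri : ∀ q p (q≤n : q ≤ q ℕ.+ p) (h : ℤ → Fin (q ℕ.+ p) → Carrier) →
    (∀ k i → k ℤ.< 0ℤ → q < pos i → h k i ≈ 0#) →
    ∀ μ → (∀ i → q < pos i → μ i ≡ 0ℤ) →
    s R h q≤n (truncate q≤n μ) *
      rowdet R (λ i j → h (1ℤ ℤ.+ + pos j ℤ.- + pos i) (cast refl (q ↑ʳ i)))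
      ≈ binarySum (q ℕ.+ p) (+ p) (λ β → s R h ≤-refl (μ ⊕ β))
  pieri q p q≤n h h≈0 μ μ≡0 = R.sym (begin
    binarySum N (+ p) (λ β → s R h ≤-refl (μ ⊕ β))
      ≈⟨ binarySum-cong N (+ p) (λ β → R.trans (rowdet≈det {N} _) (det-cong λ i j →
           R.reflexive (cong (h _) (inject≤-refl i ≤-refl)))) ⟩
    binarySum N (+ p) (λ β → det (λ i j → entry i j (β i)))
      ≈⟨ binarySum-det-transpose N (+ p) entry ⟩
    binarySum N (+ p) (λ γ → det (λ i j → entry i j (γ j)))
      ≈⟨ binarySum-sorted q p _ vanishes ⟩
    det A
      ≈⟨ det-block-triangular q p A lower-left ⟩
    det (λ i j → A (i ↑ˡ p) (j ↑ˡ p)) * det (λ i j → A (q ↑ʳ i) (q ↑ʳ j))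
      ≈⟨ R.*-cong (R.trans (rowdet≈det {q} _) (det-cong upper-left))
                  (R.trans (rowdet≈det {p} _) (det-cong lower-right)) ⟨
    s R h q≤n (truncate q≤n μ) *
      rowdet R (λ i j → h (1ℤ ℤ.+ + pos j ℤ.- + pos i) (cast refl (q ↑ʳ i))) ∎)
    where
    open +-*-Solver
    N = q ℕ.+ p

    -- The shift is a separate argument, so that it can come from the row or from the column.
    entry : Fin N → Fin N → ℤ → Carrier
    entry i j b = h (μ i ℤ.+ b ℤ.+ + pos j ℤ.- + pos i) i

    A : Matrix N
    A i j = entry i j (sorted q p j)

    vanishes : VanishesOnDescents (λ γ → det (λ i j → entry i j (γ j)))
    vanishes γ {i} {j} i⋖j γi≡1 γj≡0 = det-adjacent-columns (λ i j → entry i j (γ j)) i⋖j λ k →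
      R.reflexive (cong (λ v → h (v ℤ.- + pos k) k) (same-column (μ k)))
      where
      -- A shift by 1 in column `i` and a shift by 0 in the next column `j` reach the same index of
      -- `h`.
      same-column : ∀ x → x ℤ.+ γ i ℤ.+ + pos i ≡ x ℤ.+ γ j ℤ.+ + pos j
      same-column x rewrite γi≡1 | γj≡0 | toℕ-adjacent i⋖j =
        solve 2 (λ x y → x :+ con 1ℤ :+ y := x :+ con 0ℤ :+ (con 1ℤ :+ y)) refl x (+ pos i)

    -- Both `μ i` and the shift are 0 here, which leaves the index `pos j - pos i`. It is negative
    -- since column `j` is among the first `q` and row `i` is not; this is where the assumption on
    -- `h` enters.
    lower-left : ∀ i j → q ≤ toℕ i → toℕ j < q → A i j ≈ 0#
    lower-left i j q≤i j<q = h≈0 _ i negative (s≤s q≤i)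
      where
      sorted≡0 : sorted q p j ≡ 0ℤ
      sorted≡0 = trans (cong (sorted q p) (sym (toℕ-injective (trans (toℕ-↑ˡ _ p) (toℕ-fromℕ< j<q)))))
                       (sorted-↑ˡ p (fromℕ< j<q))

      negative : μ i ℤ.+ sorted q p j ℤ.+ + pos j ℤ.- + pos i ℤ.< 0ℤ
      negative rewrite μ≡0 i (s≤s q≤i) | sorted≡0 =
        subst (+ pos j ℤ.- + pos i ℤ.<_) (ℤₚ.+-inverseʳ (+ pos i))
          (ℤₚ.+-monoˡ-< (ℤ.- (+ pos i)) (ℤ.+<+ (s≤s (ℕₚ.≤-trans j<q q≤i))))

    upper-left : ∀ i j → h (truncate q≤n μ i ℤ.+ + pos j ℤ.- + pos i) (inject≤ i q≤n) ≈
                           A (i ↑ˡ p) (j ↑ˡ p)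
    upper-left i j = R.reflexive (cong₂ h
      (cong₂ ℤ._-_
        (cong₂ ℤ._+_
          (trans (cong μ inject≡)
            (sym (trans (cong (λ b → μ (i ↑ˡ p) ℤ.+ b) (sorted-↑ˡ p j)) (ℤₚ.+-identityʳ _))))
          (cong (λ k → + suc k) (sym (toℕ-↑ˡ j p))))
        (cong (λ k → + suc k) (sym (toℕ-↑ˡ i p))))
      inject≡)
      where
      inject≡ : inject≤ i q≤n ≡ i ↑ˡ p
      inject≡ = toℕ-injective (trans (toℕ-inject≤ i q≤n) (sym (toℕ-↑ˡ i p)))

    lower-right : ∀ i j → h (1ℤ ℤ.+ + pos j ℤ.- + pos i) (cast refl (q ↑ʳ i)) ≈ A (q ↑ʳ i) (q ↑ʳ j)
    lower-right i j = R.reflexive (cong₂ h index≡ (cast-is-id refl (q ↑ʳ i)))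
      where
      -- Here `μ` is 0 and the column shift is 1, which supplies the `1ℤ` of `e`; the offset `q` of
      -- the rows cancels that of the columns.
      index≡ : 1ℤ ℤ.+ + pos j ℤ.- + pos i ≡
               μ (q ↑ʳ i) ℤ.+ sorted q p (q ↑ʳ j) ℤ.+ + pos (q ↑ʳ j) ℤ.- + pos (q ↑ʳ i)
      index≡ rewrite μ≡0 (q ↑ʳ i) (s≤s (subst (q ≤_) (sym (toℕ-↑ʳ q i)) (ℕₚ.m≤m+n q _)))
                   | sorted-↑ʳ q j | toℕ-↑ʳ q i | toℕ-↑ʳ q j =
        solve 3 (λ x y z → con 1ℤ :+ (con 1ℤ :+ y) :- (con 1ℤ :+ z) :=
                           con 0ℤ :+ con 1ℤ :+ (con 1ℤ :+ (x :+ y)) :- (con 1ℤ :+ (x :+ z)))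
              refl (+ q) (+ toℕ j) (+ toℕ i)

corollary4p12 : ∀ {c ℓ} (R : Ring c ℓ) (n p : ℕ) (p≤n : p ≤ n) →
    let open Ring R
        q = n ∸ p
    in (h : ℤ → Fin n → Carrier) →
       (∀ k i → k ℤ.< 0ℤ → q < pos i → h k i ≈ 0#) →
       (μ : Vector ℤ n) →
       (∀ i → q < pos i → μ i ≡ 0ℤ) →
       s R h (m∸n≤m n p) (truncate (m∸n≤m n p) μ) * e R h p≤n
         ≈ sumOver R (filter (λ β → ∣ β ∣ ≟ + p) (binaryTuples n)) (λ β → s R h ≤-refl (μ ⊕ β))
corollary4p12 R n p p≤n = pieri-≡ (n ∸ p) n (m∸n≤m n p) (ℕₚ.m∸n+n≡m p≤n)
  where
  open Ring R using (Carrier; _≈_; _*_; 0#)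

  -- `n ∸ p` is generalised to a variable `q`, so that `q + p ≡ n` can be matched with `refl`.
  pieri-≡ : ∀ q n (q≤n : q ≤ n) (q+p≡n : q ℕ.+ p ≡ n) (h : ℤ → Fin n → Carrier) →
    (∀ k i → k ℤ.< 0ℤ → q < pos i → h k i ≈ 0#) →
    ∀ μ → (∀ i → q < pos i → μ i ≡ 0ℤ) →
    s R h q≤n (truncate q≤n μ) *
      rowdet R (λ i j → h (1ℤ ℤ.+ + pos j ℤ.- + pos i) (cast q+p≡n (q ↑ʳ i)))
      ≈ sumOver R (filter (λ β → ∣ β ∣ ≟ + p) (binaryTuples n)) (λ β → s R h ≤-refl (μ ⊕ β))
  pieri-≡ q n q≤n refl = pieri R q p q≤n
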